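{- $\mathsf{SSR}$ implies that $\boxminus(\kappa,\omega_1)$ fails for every regular cardinal $\kappa\ge\omega_2$.
   Context: For a set of ordinals $A$, $\mathrm{ssup}(A)=\sup\{\alpha+1\mid\alpha\in A\}$ and $\mathrm{acc}(A)=\{\alpha\in A\mid\sup(A\cap\alpha)=\alpha>0\}$; $E^\lambda_{\omega_1}$ is the set of ordinals below $\lambda$ of cofinality $\omega_1$, and $E^\kappa_{\ne\theta}$ those of cofinality $\ne\theta$. For countable $x,y\subseteq\lambda$ ($\lambda\ge\omega_2$ regular), $x\sqsubseteq^* y$ means: $x\cap\omega_1=y\cap\omega_1$, $\mathrm{ssup}(x)=\mathrm{ssup}(y)$, and $\mathrm{ssup}(x\cap\gamma)=\mathrm{ssup}(y\cap\gamma)$ for every $\gamma\in x\cap E^\lambda_{\omega_1}$. $\mathsf{SSR}$ (Semi-Stationary Reflection) is taken to be the assertion: for every regular $\lambda\ge\omega_2$ and every stationary $S\subseteq[\lambda]^{\aleph_0}$ that is closed upwards under $\sqsubseteq^*$, there is $W\in[\lambda]^{\aleph_1}$ with $\omega_1\subseteq W$ such that $S\cap[W]^{\aleph_0}$ is stationary in $[W]^{\aleph_0}$. For regular $\theta<\kappa$, $\boxminus(\kappa,\theta)$ asserts the existence of $\Gamma$ and $\langle C_{\alpha,i}\mid\alpha\in\Gamma,\ i(\alpha)\le i<\theta\rangle$ such that: (1) $E^\kappa_{\ne\theta}\cap\mathrm{acc}(\kappa)\subseteq\Gamma\subseteq\mathrm{acc}(\kappa)$; (2) for $\alpha\in\Gamma$,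 $i(\alpha)<\theta$ and $\langle C_{\alpha,i}\mid i(\alpha)\le i<\theta\rangle$ is a $\subseteq$-increasing sequence of clubs in $\alpha$ with $\Gamma\cap\alpha=\bigcup_{i}\mathrm{acc}(C_{\alpha,i})$; (3) for $\alpha\in\Gamma$, $i(\alpha)\le i<\theta$, $\bar\alpha\in\mathrm{acc}(C_{\alpha,i})$: $i(\bar\alpha)\le i$ and $C_{\bar\alpha,i}=C_{\alpha,i}\cap\bar\alpha$; (4) for every club $D\subseteq\kappa$ there is $\alpha\in\mathrm{acc}(D)\cap\Gamma$ with $D\cap\alpha\ne C_{\alpha,i}$ for all $i$. -}

module Defs where

open import Level using (Level; suc; _⊔_)
open import Data.Nat.Base using (ℕ) renaming (suc to 1+)
open import Data.Product using (Σ-syntax; ∃-syntax; _×_)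
open import Induction.WellFounded using (WellFounded)
open import Relation.Binary.Core using (Rel)
open import Relation.Binary.Definitions using (_Respects_)
open import Relation.Binary.Structures using (IsStrictTotalOrder)
import Relation.Binary.Construct.StrictToNonStrict as StrictToNonStrict
open import Relation.Binary.PropositionalEquality using (_≡_)
open import Relation.Nullary using (¬_)
open import Relation.Unary using (Pred; U; _∈_; _∩_; _⊆_; _≐_; ⋃)

private variable
  a b c d : Level

-- Cardinality of subsets.  Functions are total on the ambient type; their
-- values outside the given subset are irrelevant.

module _ {X : Set a} {Y : Set b} where

  InjectiveOn : Pred X c → (X → Y) → Set (a ⊔ b ⊔ c)
  InjectiveOn A f = ∀ {x x′} → x ∈ A → x′ ∈ A → f x ≡ f x′ → x ≡ x′

  -- |A| ≤ |B|
  infix 4 _≼_ _≃_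
  _≼_ : Pred X c → Pred Y d → Set (a ⊔ b ⊔ c ⊔ d)
  A ≼ B = ∃[ f ] (∀ x → x ∈ A → f x ∈ B) × InjectiveOn A f

  -- |A| = |B|
  _≃_ : Pred X c → Pred Y d → Set (a ⊔ b ⊔ c ⊔ d)
  A ≃ B = ∃[ f ] (∀ x → x ∈ A → f x ∈ B) × InjectiveOn A f
               × (∀ y → y ∈ B → ∃[ x ] x ∈ A × f x ≡ y)

-- An ordinal κ is a well-ordered type.  Its elements are the ordinals below κ
-- (an element α stands for the order type of ↓ α), and sets of ordinals below κ
-- are predicates on it, compared by _≐_.

record Ordinal (ℓ : Level) : Set (suc ℓ) where
  field
    Carrier            : Set ℓ
    _<_                : Rel Carrier ℓ
    isStrictTotalOrder : IsStrictTotalOrder _≡_ _<_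
    wellFounded        : WellFounded _<_

module Below {ℓ : Level} (κ : Ordinal ℓ) where

  open Ordinal κ public using (_<_) renaming (Carrier to K)
  open StrictToNonStrict {A = K} _≡_ _<_ public using (_≤_)

  ↓_ : K → Pred K ℓ
  ↓ α = λ β → β < α

  IsSup : Pred K a → K → Set (ℓ ⊔ a)
  IsSup A σ = (∀ α → α ∈ A → α ≤ σ) × (∀ τ → (∀ α → α ∈ A → α ≤ τ) → σ ≤ τ)

  IsSuccessorOf : K → K → Set ℓ
  IsSuccessorOf α β = α < β × (∀ γ → α < γ → β ≤ γ)

  IsSsup : Pred K a → K → Set (ℓ ⊔ a)
  IsSsup A = IsSup (λ β → ∃[ α ] α ∈ A × IsSuccessorOf α β)

  SameSsup : Pred K a → Pred K b → Set (ℓ ⊔ a ⊔ b)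
  SameSsup A B = ∃[ σ ] IsSsup A σ × IsSsup B σ

  acc : Pred K a → Pred K (ℓ ⊔ a)
  acc A α = α ∈ A × IsSup (A ∩ ↓ α) α × (∃[ β ] β < α)

  -- f restricts to a map from the ordinal β onto a cofinal subset of A.
  IsCofinalMap : K → (K → K) → Pred K a → Set (ℓ ⊔ a)
  IsCofinalMap β f A = (∀ ξ → ξ < β → f ξ ∈ A)
                     × (∀ γ → γ ∈ A → ∃[ ξ ] ξ < β × γ ≤ f ξ)

  HasCofinality : K → K → Set ℓ
  HasCofinality α θ = (∃[ f ] IsCofinalMap θ f (↓ α))
                    × (∀ β → β < θ → ¬ (∃[ f ] IsCofinalMap β f (↓ α)))

  -- κ is infinite and cf(κ) = κ.
  IsRegular : Set ℓ
  IsRegular = U {A = ℕ} ≼ U {A = K}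
            × (∀ β → ¬ (∃[ f ] IsCofinalMap β f U))

  IsInitialSegment : Pred K ℓ → Set ℓ
  IsInitialSegment A = ∀ α β → β < α → α ∈ A → β ∈ A

  -- As an ordinal, the initial segment A is the least one of cardinality
  -- greater than |B|.
  IsNextCardinal : {Y : Set b} → Pred K ℓ → Pred Y c → Set (ℓ ⊔ b ⊔ c)
  IsNextCardinal A B = ¬ (A ≼ B) × (∀ α → α ∈ A → ↓ α ≼ B)

  Isω₁ : K → Set ℓ
  Isω₁ ω₁ = IsNextCardinal (↓ ω₁) (U {A = ℕ})

  -- ω₂ ≤ κ: some initial segment of κ, possibly all of it, is ω₂.
  ω₂≤-given-ω₁ : K → Set (suc ℓ)
  ω₂≤-given-ω₁ ω₁ = ∃[ A ] IsInitialSegment A × IsNextCardinal A (↓ ω₁)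

  -- C is a club in A, where A is either U (that is, κ) or ↓ α.
  IsClubIn : Pred K a → Pred K b → Set (ℓ ⊔ a ⊔ b)
  IsClubIn A C = C ⊆ A
               × (∀ β → β ∈ A → ∃[ γ ] γ ∈ C × β ≤ γ)
               × (∀ δ → δ ∈ A → (∃[ β ] β < δ) → IsSup (C ∩ ↓ δ) δ → δ ∈ C)

  [_]^ℵ₀ : Pred K a → Pred (Pred K ℓ) (ℓ ⊔ a)
  [ W ]^ℵ₀ x = x ⊆ W × U {A = ℕ} ≃ x

  IsClubIn[_]^ℵ₀ : Pred K a → Pred (Pred K ℓ) ℓ → Set (suc ℓ ⊔ a)
  IsClubIn[ W ]^ℵ₀ 𝒞 =
      𝒞 Respects _≐_
    × 𝒞 ⊆ [ W ]^ℵ₀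
    × (∀ x → x ∈ [ W ]^ℵ₀ → ∃[ y ] y ∈ 𝒞 × x ⊆ y)
    × (∀ (x : ℕ → Pred K ℓ) → (∀ n → x n ∈ 𝒞) → (∀ n → x n ⊆ x (1+ n)) →
         ⋃[ n ∶ ℕ ] x n ∈ 𝒞)

  -- S ∩ [W]^ℵ₀ is stationary in [W]^ℵ₀ (clubs are contained in [W]^ℵ₀).
  IsStationaryIn[_]^ℵ₀ : Pred K a → Pred (Pred K ℓ) ℓ → Set (suc ℓ ⊔ a)
  IsStationaryIn[ W ]^ℵ₀ S = ∀ 𝒞 → IsClubIn[ W ]^ℵ₀ 𝒞 → ∃[ x ] x ∈ S × x ∈ 𝒞

  -- The relation ⊑*, with ω₁ given as an element of κ.
  ⊑* : K → Pred K ℓ → Pred K ℓ → Set ℓ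
  ⊑* ω₁ x y = (x ∩ ↓ ω₁) ≐ (y ∩ ↓ ω₁)
            × SameSsup x y
            × (∀ γ → γ ∈ x → HasCofinality γ ω₁ → SameSsup (x ∩ ↓ γ) (y ∩ ↓ γ))

  -- C α i is meaningful only for α ∈ Γ and i₀ α ≤ i < θ, and i₀ α only for
  -- α ∈ Γ.
  record ⊟ (θ : K) : Set (suc ℓ) where
    field
      Γ  : Pred K ℓ
      i₀ : K → K
      C  : K → K → Pred K ℓ

      acc-cof≢θ⊆Γ : ∀ α → α ∈ acc U → ¬ HasCofinality α θ → α ∈ Γ
      Γ⊆acc       : Γ ⊆ acc U

      i₀<θ       : ∀ α → α ∈ Γ → i₀ α < θ
      club       : ∀ α i → α ∈ Γ → i₀ α ≤ i → i < θ → IsClubIn (↓ α) (C α i)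
      increasing : ∀ α i j → α ∈ Γ → i₀ α ≤ i → i ≤ j → j < θ → C α i ⊆ C α j
      covering   : ∀ α → α ∈ Γ →
                   (Γ ∩ ↓ α) ≐ (λ β → ∃[ i ] i₀ α ≤ i × i < θ × β ∈ acc (C α i))

      i₀-coherent : ∀ α i ᾱ → α ∈ Γ → i₀ α ≤ i → i < θ → ᾱ ∈ acc (C α i) → i₀ ᾱ ≤ i
      C-coherent  : ∀ α i ᾱ → α ∈ Γ → i₀ α ≤ i → i < θ → ᾱ ∈ acc (C α i) →
                    C ᾱ i ≐ (C α i ∩ ↓ ᾱ)

      nontrivial : ∀ (D : Pred K ℓ) → IsClubIn U D →
                   ∃[ α ] α ∈ acc D × α ∈ Γ ×
                     (∀ i → i₀ α ≤ i → i < θ → ¬ ((D ∩ ↓ α) ≐ C α i))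

SSR : (ℓ : Level) → Set (suc ℓ)
SSR ℓ = (μ : Ordinal ℓ) → let open Below μ in
  (ω₁ : K) → IsRegular → Isω₁ ω₁ → ω₂≤-given-ω₁ ω₁ →
  (S : Pred (Pred K ℓ) ℓ) → S Respects _≐_ → S ⊆ [ U ]^ℵ₀ →
  IsStationaryIn[ U ]^ℵ₀ S →
  (∀ x y → x ∈ S → y ∈ [ U ]^ℵ₀ → ⊑* ω₁ x y → y ∈ S) →
  Σ[ W ∈ Pred K ℓ ] ↓ ω₁ ≃ W × ↓ ω₁ ⊆ W × IsStationaryIn[ W ]^ℵ₀ S

open Below using (IsRegular; Isω₁; ω₂≤-given-ω₁; ⊟) public

-- Write η ◁[ δ ] α for η ∈ acc (C α δ).  For η ∈ Γ let Bad η be the set of the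
-- countable x, with supremum α ∈ Γ above η, such that η ◁[ δ ] α fails for some
-- δ ≥ ssup (x ∩ ω₁).
--
-- Bad η reflects to no W of size ℵ₁: fix α* ∈ Γ above W and η.  The limits of
-- ω-sequences from W lie in Γ ∩ α*, hence in some acc (C α* j) with j < ω₁, so
-- for club many x ⊆ W both ssup x and η belong to acc (C α* δ) for every
-- δ ≥ ssup (x ∩ ω₁), and η ◁[ δ ] ssup x by coherence.  Hence, under SSR, some
-- club 𝒞 of countable sets is disjoint from Bad η.
--
-- In a closed game of length ω a player builds a member x of 𝒞, answering lower
-- bounds for the next ordinal put into x, and keeping x ∩ ω₁ below δ.  She wins
-- for some δ: otherwise strategies against her for all δ < ω₁ could be followed
-- at once, by regularity of κ, although x ∩ ω₁ is bounded in ω₁.  Some δ serves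
-- unboundedly many η.  Interleaving the games of two of them, η < η′, gives
-- members of the two clubs with a common supremum α, so η ◁[ δ ] α and
-- η′ ◁[ δ ] α, hence η ◁[ δ ] η′.  The union of the C η δ for these η is
-- then a club threading the square.
module Submission where

open import Defs
open import Level using (Level; suc; Lift; lift; lower)
open import Axiom.ExcludedMiddle using (ExcludedMiddle)
open import Relation.Nullary using (¬_)

open import Data.Empty using (⊥-elim)
open import Data.List.Base using (List; []; _∷_)
import Data.List.Membership.DecPropositional as DecMembership
open import Data.List.Membership.Propositional.Properties using (finite)
open import Data.List.Relation.Unary.Any using (here; there)
open import Data.Nat.Base as ℕ using (ℕ; zero) renaming (suc to 1+)
import Data.Nat.Properties as ℕ
open import Data.Product using (∃-syntax; _×_; _,_; proj₁; proj₂)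
open import Data.Sum.Base using (_⊎_; inj₁; inj₂)
open import Data.Unit.Base using (tt)
open import Function.Bundles using (mk↣)
open import Induction.WellFounded using (Acc) renaming (acc to mkAcc)
import Relation.Binary.Construct.StrictToNonStrict as StrictToNonStrict
open import Relation.Binary.Definitions using (tri<; tri≈; tri>)
open import Relation.Binary.Structures using (IsStrictTotalOrder)
open import Relation.Binary.PropositionalEquality using (_≡_; refl; sym; trans; cong; subst)
open import Relation.Nullary using (Dec; yes; no; contradiction)
open import Relation.Nullary.Decidable using (map′; ¬?; decidable-stable)
open import Relation.Unary using (Pred; U; _∈_; _∩_; _⊆_; _≐_; ⋃)

-- Pairing of natural numbers and least witnesses.

nextPair : ℕ × ℕ → ℕ × ℕ
nextPair (zero , b) = 1+ b , zero
nextPair (1+ a , b) = a , 1+ b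

-- Cantor's enumeration by antidiagonals, each walked from `(s , 0)` to `(0 , s)`.
unpair : ℕ → ℕ × ℕ
unpair zero   = zero , zero
unpair (1+ n) = nextPair (unpair n)

unpair-surjective : ∀ a b → ∃[ n ] unpair n ≡ (a , b)
unpair-surjective a b = onDiagonal (a ℕ.+ b) b a refl
  where
  onDiagonal : ∀ s b a → a ℕ.+ b ≡ s → ∃[ n ] unpair n ≡ (a , b)
  onDiagonal s (1+ b) a eq =
    let n , p = onDiagonal s b (1+ a) (trans (sym (ℕ.+-suc a b)) eq) in
    1+ n , cong nextPair p
  onDiagonal zero zero zero eq = zero , refl
  onDiagonal (1+ s) zero (1+ a) eq =
    let n , p = onDiagonal s a zero (trans (sym (ℕ.+-identityʳ a)) (ℕ.suc-injective eq)) in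
    1+ n , cong nextPair p

pair : ℕ → ℕ → ℕ
pair a b = proj₁ (unpair-surjective a b)

unpair-pair : ∀ a b → unpair (pair a b) ≡ (a , b)
unpair-pair a b = proj₂ (unpair-surjective a b)

pair-injective : ∀ a b a′ b′ → pair a b ≡ pair a′ b′ → (a , b) ≡ (a′ , b′)
pair-injective a b a′ b′ eq =
  trans (sym (unpair-pair a b)) (trans (cong unpair eq) (unpair-pair a′ b′))

leastℕ : ∀ {p} {P : Pred ℕ p} → (∀ n → Dec (P n)) → ∀ n → P n →
         ∃[ m ] P m × (∀ k → k ℕ.< m → ¬ P k)
leastℕ {P = P} P? n Pn = go n 0 (λ _ ()) (subst P (sym (ℕ.+-identityʳ n)) Pn)
  where
  go : ∀ fuel k → (∀ j → j ℕ.< k → ¬ P j) → P (fuel ℕ.+ k) →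
       ∃[ m ] P m × (∀ j → j ℕ.< m → ¬ P j)
  go fuel k below Pend with P? k
  go fuel k below Pend | yes Pk = k , Pk , below
  go zero k below Pend | no ¬Pk = contradiction Pend ¬Pk
  go (1+ fuel) k below Pend | no ¬Pk =
    go fuel (1+ k) below′ (subst P (sym (ℕ.+-suc fuel k)) Pend)
    where
    below′ : ∀ j → j ℕ.< 1+ k → ¬ P j
    below′ j j<1+k with ℕ.m<1+n⇒m<n∨m≡n j<1+k
    ... | inj₁ j<k  = below j j<k
    ... | inj₂ refl = ¬Pk

-- Classical reasoning and the order on κ.

module _ {ℓ : Level} (em : ExcludedMiddle (suc ℓ)) (κ : Ordinal ℓ) where

  open Below κ hiding (IsRegular; Isω₁; ω₂≤-given-ω₁; ⊟)
  open IsStrictTotalOrder (Ordinal.isStrictTotalOrder κ)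
    using (compare; _≟_; _<?_; <-resp-≈; irrefl) renaming (trans to <-trans)
  open DecMembership _≟_ using (_∈?_) renaming (_∈_ to _∈ₗ_)

  -- Excluded middle is assumed at the level of statements that quantify over clubs of countable
  -- sets; statements at level ℓ are lifted there.
  dec : (P : Set ℓ) → Dec P
  dec P = map′ lower lift (em {Lift (suc ℓ) P})

  stable : {P : Set ℓ} → ¬ ¬ P → P
  stable {P} = decidable-stable (dec P)

  <-≤-trans : ∀ {a b c} → a < b → b ≤ c → a < c
  <-≤-trans = StrictToNonStrict.<-≤-trans _≡_ _<_ <-trans (proj₁ <-resp-≈)

  ≤-<-trans : ∀ {a b c} → a ≤ b → b < c → a < c
  ≤-<-trans = StrictToNonStrict.≤-<-trans _≡_ _<_ sym <-trans (proj₂ <-resp-≈)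

  ≤-refl : ∀ {a} → a ≤ a
  ≤-refl = inj₂ refl

  ≤-trans : ∀ {a b c} → a ≤ b → b ≤ c → a ≤ c
  ≤-trans (inj₁ a<b)  b≤c = inj₁ (<-≤-trans a<b b≤c)
  ≤-trans (inj₂ refl) b≤c = b≤c

  <-irrefl : ∀ {a} → ¬ a < a
  <-irrefl = irrefl refl

  <⇒≱ : ∀ {a b} → a < b → ¬ b ≤ a
  <⇒≱ a<b b≤a = <-irrefl (<-≤-trans a<b b≤a)

  ≮⇒≥ : ∀ {a b} → ¬ a < b → b ≤ a
  ≮⇒≥ {a} {b} a≮b with compare a b
  ... | tri< a<b _ _  = contradiction a<b a≮b
  ... | tri≈ _ refl _ = ≤-refl
  ... | tri> _ _ b<a  = inj₁ b<a

  ≰⇒> : ∀ {a b} → ¬ a ≤ b → b < a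
  ≰⇒> {a} {b} a≰b with compare a b
  ... | tri< a<b _ _  = contradiction (inj₁ a<b) a≰b
  ... | tri≈ _ refl _ = contradiction ≤-refl a≰b
  ... | tri> _ _ b<a  = b<a

  ≤-antisym : ∀ {a b} → a ≤ b → b ≤ a → a ≡ b
  ≤-antisym (inj₁ a<b) b≤a = contradiction b≤a (<⇒≱ a<b)
  ≤-antisym (inj₂ a≡b) _   = a≡b

  least : (P : Pred K ℓ) → ∃[ a ] P a → ∃[ m ] P m × (∀ b → P b → m ≤ b)
  least P (a , Pa) = go a (Ordinal.wellFounded κ a) Pa
    where
    go : ∀ a → Acc _<_ a → P a → ∃[ m ] P m × (∀ b → P b → m ≤ b)
    go a (mkAcc rs) Pa with dec (∃[ b ] b < a × P b)
    ... | yes (b , b<a , Pb) = go b (rs b<a) Pb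
    ... | no none = a , Pa , λ b Pb → ≮⇒≥ λ b<a → none (b , b<a , Pb)

  -- Bijective enumerations of countably infinite sets.

  Enumerates : ∀ {p} → (ℕ → K) → Pred K p → Set _
  Enumerates e A = (∀ n → e n ∈ A) × (∀ x → x ∈ A → ∃[ n ] e n ≡ x)

  -- The n-th value of the bijection is the first entry of the enumeration that
  -- differs from the earlier values.
  enumerable⇒ℕ≃ : ∀ {p} {A : Pred K p} (e : ℕ → K) → Enumerates e A →
                  (ι : ℕ → K) → (∀ n → ι n ∈ A) → (∀ {m n} → ι m ≡ ι n → m ≡ n) →
                  U {A = ℕ} ≃ A
  enumerable⇒ℕ≃ {A = A} e (e∈A , e-onto) ι ι∈A ι-inj =
    f , (λ n _ → e∈A _) , (λ _ _ → f-injective) ,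
    λ x x∈A → let k , ek≡x = e-onto x x∈A
                  n , fn≡  = earlier (1+ k) (covers (1+ k) k ℕ.≤-refl)
              in n , tt , trans fn≡ ek≡x
    where
    outside : ∀ L → ∃[ m ] ¬ (e m ∈ₗ L)
    outside L with dec (Lift ℓ (∃[ m ] ¬ (e m ∈ₗ L)))
    ... | yes (lift p) = p
    ... | no none = contradiction ι∈L (finite (mk↣ ι-inj) L)
      where
      ι∈L : ∀ n → ι n ∈ₗ L
      ι∈L n with e-onto (ι n) (ι∈A n)
      ... | m , em≡ = subst (_∈ₗ L) em≡
                        (decidable-stable (e m ∈? L) λ ∉ → none (lift (m , ∉)))

    fresh : ∀ L → ∃[ m ] ¬ (e m ∈ₗ L) × (∀ k → k ℕ.< m → ¬ ¬ (e k ∈ₗ L))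
    fresh L = let m , em∉L = outside L in leastℕ (λ n → ¬? (e n ∈? L)) m em∉L

    values : ℕ → List K
    values zero   = []
    values (1+ n) = e (proj₁ (fresh (values n))) ∷ values n

    f : ℕ → K
    f n = e (proj₁ (fresh (values n)))

    f∈values : ∀ {m n} → m ℕ.< n → f m ∈ₗ values n
    f∈values {m} {1+ n} m<1+n with ℕ.m<1+n⇒m<n∨m≡n m<1+n
    ... | inj₁ m<n  = there (f∈values m<n)
    ... | inj₂ refl = here refl

    f∉values : ∀ n → ¬ (f n ∈ₗ values n)
    f∉values n = proj₁ (proj₂ (fresh (values n)))

    f-injective : ∀ {m n} → f m ≡ f n → m ≡ n
    f-injective {m} {n} eq with ℕ.<-cmp m n
    ... | tri< m<n _ _ = contradiction (subst (_∈ₗ values n) eq (f∈values m<n)) (f∉values n)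
    ... | tri≈ _ m≡n _ = m≡n
    ... | tri> _ _ n<m = contradiction (subst (_∈ₗ values m) (sym eq) (f∈values n<m)) (f∉values m)

    earlier : ∀ n {x} → x ∈ₗ values n → ∃[ k ] f k ≡ x
    earlier (1+ n) (here x≡) = n , sym x≡
    earlier (1+ n) (there x∈) = earlier n x∈

    -- Entry `n` is either listed before stage `n` or, all smaller entries being listed, the first
    -- unlisted one.
    covers : ∀ n k → k ℕ.< n → e k ∈ₗ values n
    covers (1+ n) k k<1+n with ℕ.m<1+n⇒m<n∨m≡n k<1+n
    ... | inj₁ k<n = there (covers n k k<n)
    ... | inj₂ refl with e n ∈? values n
    ...   | yes en∈ = there en∈
    ...   | no en∉ with fresh (values n)
    ...     | m , em∉ , below with ℕ.<-cmp m n
    ...       | tri< m<n _ _  = contradiction (covers n m m<n) em∉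
    ...       | tri≈ _ refl _ = here refl
    ...       | tri> _ _ n<m  = contradiction en∉ (below n n<m)

  -- Bounds from the regularity of ω₁ and of κ.

  module _ (regular : IsRegular κ) (ω₁ : K) (isω₁ : Isω₁ κ ω₁) where

    ω₁-nonempty : ∃[ ξ ] ξ < ω₁
    ω₁-nonempty with dec (∃[ ξ ] ξ < ω₁)
    ... | yes p = p
    ... | no empty = ⊥-elim (proj₁ isω₁
            ((λ _ → 0) , (λ _ _ → tt) , λ x∈ → contradiction (_ , x∈) empty))

    0ᵏ : K
    0ᵏ = proj₁ ω₁-nonempty

    -- An unbounded sequence would exhaust `↓ ω₁` by countably many countable segments. Then `code`
    -- would inject it into ℕ: a ζ ≤ s n is coded by n and its rank in `↓ (s n)`, with 0 kept for ζ
    -- = s n.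
    ω₁-bounded : (s : ℕ → K) → (∀ n → s n < ω₁) → ∃[ ζ ] ζ < ω₁ × (∀ n → s n < ζ)
    ω₁-bounded s s<ω₁ = stable λ none → proj₁ isω₁ (code none , (λ _ _ → tt) , code-injective none)
      where
      module _ (none : ¬ (∃[ ζ ] ζ < ω₁ × (∀ n → s n < ζ))) where
        reached : ∀ ζ → ζ < ω₁ → ∃[ n ] ζ ≤ s n
        reached ζ ζ<ω₁ = stable λ ¬p → none (ζ , ζ<ω₁ , λ n → ≰⇒> λ ζ≤ → ¬p (n , ζ≤))

        rank : ℕ → K → ℕ
        rank n = proj₁ (proj₂ isω₁ (s n) (s<ω₁ n))

        rank-injective : ∀ n {ζ ζ′} → ζ < s n → ζ′ < s n → rank n ζ ≡ rank n ζ′ → ζ ≡ ζ′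
        rank-injective n = proj₂ (proj₂ (proj₂ isω₁ (s n) (s<ω₁ n)))

        codeBelow : ∀ {ζ} → (∃[ n ] ζ ≤ s n) → ℕ
        codeBelow {ζ} (n , inj₁ _) = pair n (1+ (rank n ζ))
        codeBelow     (n , inj₂ _) = pair n 0

        code : K → ℕ
        code ζ with ζ <? ω₁
        ... | yes ζ<ω₁ = codeBelow (reached ζ ζ<ω₁)
        ... | no _     = 0

        codeBelow-injective : ∀ {ζ ζ′} (p : ∃[ n ] ζ ≤ s n) (q : ∃[ n ] ζ′ ≤ s n) →
                              codeBelow p ≡ codeBelow q → ζ ≡ ζ′
        codeBelow-injective {ζ} {ζ′} (n , p) (n′ , q) eq = go p q eq
          where
          go : (p : ζ ≤ s n) (q : ζ′ ≤ s n′) → codeBelow (n , p) ≡ codeBelow (n′ , q) → ζ ≡ ζ′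
          go (inj₁ p) (inj₁ q) eq with pair-injective n (1+ (rank n ζ)) n′ (1+ (rank n′ ζ′)) eq
          ... | eq′ with cong proj₁ eq′
          ...   | refl = rank-injective n p q (ℕ.suc-injective (cong proj₂ eq′))
          go (inj₁ p) (inj₂ q) eq with cong proj₂ (pair-injective n (1+ (rank n ζ)) n′ 0 eq)
          ... | ()
          go (inj₂ p) (inj₁ q) eq with cong proj₂ (pair-injective n 0 n′ (1+ (rank n′ ζ′)) eq)
          ... | ()
          go (inj₂ p) (inj₂ q) eq with cong proj₁ (pair-injective n 0 n′ 0 eq)
          ... | refl = trans p (sym q)

        code-injective : ∀ {ζ ζ′} → ζ < ω₁ → ζ′ < ω₁ → code ζ ≡ code ζ′ → ζ ≡ ζ′
        code-injective {ζ} {ζ′} ζ<ω₁ ζ′<ω₁ eq with ζ <? ω₁ | ζ′ <? ω₁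
        ... | yes p | yes q = codeBelow-injective (reached ζ p) (reached ζ′ q) eq
        ... | no ≮  | _     = contradiction ζ<ω₁ ≮
        ... | yes _ | no ≮  = contradiction ζ′<ω₁ ≮

    bounded-on : (β : K) (s : K → K) → ∃[ γ ] (∀ ξ → ξ < β → s ξ < γ)
    bounded-on β s = stable λ none → proj₂ regular β
      (s , (λ _ _ → tt) , λ γ _ → stable λ ¬p →
        none (γ , λ ξ ξ<β → ≰⇒> λ γ≤ → ¬p (ξ , ξ<β , γ≤)))

    above : (a : K) → ∃[ b ] a < b
    above a = let γ , s<γ = bounded-on ω₁ (λ _ → a) in γ , s<γ 0ᵏ (proj₂ ω₁-nonempty)

    upper₂ : (a b : K) → ∃[ c ] a < c × b < c
    upper₂ a b with compare a b
    ... | tri< a<b _ _  = let c , b<c = above b in c , <-trans a<b b<c , b<c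
    ... | tri≈ _ refl _ = let c , a<c = above a in c , a<c , a<c
    ... | tri> _ _ b<a  = let c , a<c = above a in c , a<c , <-trans b<a a<c

    increasing⇒< : (s : ℕ → K) → (∀ n → s n < s (1+ n)) → ∀ {m n} → m ℕ.< n → s m < s n
    increasing⇒< s inc {m} {1+ n} m<1+n with ℕ.m<1+n⇒m<n∨m≡n m<1+n
    ... | inj₁ m<n  = <-trans (increasing⇒< s inc m<n) (inc n)
    ... | inj₂ refl = inc n

    increasing⇒injective : (s : ℕ → K) → (∀ n → s n < s (1+ n)) → ∀ {m n} → s m ≡ s n → m ≡ n
    increasing⇒injective s inc {m} {n} eq with ℕ.<-cmp m n
    ... | tri< m<n _ _ = contradiction (increasing⇒< s inc m<n) (irrefl eq)
    ... | tri≈ _ m≡n _ = m≡n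
    ... | tri> _ _ n<m = contradiction (increasing⇒< s inc n<m) (irrefl (sym eq))

    -- A copy of ω inside `↓ ω₁`. Regularity speaks of families indexed by elements of κ, so
    -- `bounded` carries sequences over to these indices.
    ωSequence : ℕ → ∃[ ξ ] ξ < ω₁
    ωSequence zero   = ω₁-nonempty
    ωSequence (1+ n) = let ξ , ξ<ω₁ = ωSequence n
                           ζ , ζ<ω₁ , _ = ω₁-bounded (λ _ → ξ) (λ _ → ξ<ω₁)
                       in ζ , ζ<ω₁

    ω : ℕ → K
    ω n = proj₁ (ωSequence n)

    ω<ω₁ : ∀ n → ω n < ω₁
    ω<ω₁ n = proj₂ (ωSequence n)

    ω-increasing : ∀ n → ω n < ω (1+ n)
    ω-increasing n = let ξ , ξ<ω₁ = ωSequence n in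
      proj₂ (proj₂ (ω₁-bounded (λ _ → ξ) (λ _ → ξ<ω₁))) 0

    ω-injective : ∀ {m n} → ω m ≡ ω n → m ≡ n
    ω-injective = increasing⇒injective ω ω-increasing

    bounded : (s : ℕ → K) → ∃[ γ ] (∀ n → s n < γ)
    bounded s = let γ , s′<γ = bounded-on ω₁ s′ in
                γ , λ n → subst (_< γ) (s′-ω n) (s′<γ (ω n) (ω<ω₁ n))
      where
      s′ : K → K
      s′ ξ with dec (Lift ℓ (∃[ n ] ω n ≡ ξ))
      ... | yes (lift (n , _)) = s n
      ... | no _               = ξ

      s′-ω : ∀ n → s′ (ω n) ≡ s n
      s′-ω n with dec (Lift ℓ (∃[ m ] ω m ≡ ω n))
      ... | yes (lift (m , eq)) = cong s (ω-injective eq)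
      ... | no none             = contradiction (lift (n , refl)) none

    -- Strict suprema and limits of ω-sequences.

    IsStrictSup : ∀ {p} → Pred K p → K → Set _
    IsStrictSup A α = (∀ a → a ∈ A → a < α) × (∀ τ → (∀ a → a ∈ A → a < τ) → α ≤ τ)

    module _ {p} {A : Pred K p} where

      successor : ∀ a → ∃[ b ] IsSuccessorOf a b
      successor a = let b , a<b , least-b = least (a <_) (above a) in b , a<b , least-b

      IsSsup⇒IsStrictSup : ∀ {α} → IsSsup A α → IsStrictSup A α
      IsSsup⇒IsStrictSup {α} (upper , min) =
        (λ a a∈A → let b , a⋖b = successor a in
                   <-≤-trans (proj₁ a⋖b) (upper b (a , a∈A , a⋖b))) ,
        λ τ A<τ → min τ λ { b (a , a∈A , (_ , b-min)) → b-min τ (A<τ a a∈A) }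

      IsStrictSup⇒IsSsup : ∀ {α} → IsStrictSup A α → IsSsup A α
      IsStrictSup⇒IsSsup (upper , min) =
        (λ { b (a , a∈A , (_ , b-min)) → b-min _ (upper a a∈A) }) ,
        λ τ le → min τ λ a a∈A → let b , a⋖b = successor a in
                   <-≤-trans (proj₁ a⋖b) (le b (a , a∈A , a⋖b))

    IsSsup-unique : ∀ {p} {A : Pred K p} {α β} → IsSsup A α → IsSsup A β → α ≡ β
    IsSsup-unique (upper , min) (upper′ , min′) = ≤-antisym (min _ upper′) (min′ _ upper)

    Range : (ℕ → K) → Pred K ℓ
    Range s x = Lift ℓ (∃[ n ] s n ≡ x)

    lub : (s : ℕ → K) → ∃[ γ ] IsStrictSup (Range s) γ
    lub s = let b , s<b = bounded s
                γ , s<γ , γ-min = least (λ γ → ∀ a → a ∈ Range s → a < γ)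
                                        (b , λ { a (lift (n , refl)) → s<b n })
            in γ , s<γ , γ-min

    module _ {s : ℕ → K} (s-inc : ∀ n → s n < s (1+ n)) {γ : K} (γ-sup : IsStrictSup (Range s) γ) where

      s<lub : ∀ n → s n < γ
      s<lub n = proj₁ γ-sup _ (lift (n , refl))

      below-lub : ∀ {a} → a < γ → ∃[ n ] a ≤ s n
      below-lub a<γ = stable λ none → <⇒≱ a<γ (proj₂ γ-sup _
        λ { _ (lift (n , refl)) → ≰⇒> λ a≤ → none (n , a≤) })

      lub∈acc : γ ∈ acc U
      lub∈acc = tt , ((λ a a<γ → inj₁ (proj₂ a<γ)) , min) , s 0 , s<lub 0
        where
        min : ∀ τ → (∀ a → a ∈ (U ∩ ↓ γ) → a ≤ τ) → γ ≤ τ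
        min τ le = proj₂ γ-sup τ
          λ { _ (lift (n , refl)) → <-≤-trans (s-inc n) (le _ (tt , s<lub (1+ n))) }

      -- Countably many arguments of a map from ω₁ already reach past every `s n`, and they are
      -- bounded by some ζ < ω₁. The map is then still cofinal on ζ.
      lub-cofinality : ¬ HasCofinality γ ω₁
      lub-cofinality ((f , f∈ , f-cofinal) , minimal) =
        minimal ζ ζ<ω₁ (f , (λ ξ ξ<ζ → f∈ ξ (<-trans ξ<ζ ζ<ω₁)) , cofinal)
        where
        preimage : ∀ n → ∃[ ξ ] ξ < ω₁ × s n ≤ f ξ
        preimage n = f-cofinal (s n) (s<lub n)

        bound = ω₁-bounded (λ n → proj₁ (preimage n)) (λ n → proj₁ (proj₂ (preimage n)))
        ζ = proj₁ bound
        ζ<ω₁ = proj₁ (proj₂ bound)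

        cofinal : ∀ a → a ∈ ↓ γ → ∃[ ξ ] ξ < ζ × a ≤ f ξ
        cofinal a a<γ = let n , a≤sn = below-lub a<γ
                            ξ , _ , sn≤fξ = preimage n
                        in ξ , proj₂ (proj₂ bound) n , ≤-trans a≤sn sn≤fξ

    -- Countable subsets of κ.

    countable⇒bounded : (x : Pred K ℓ) → U {A = ℕ} ≃ x → ∃[ γ ] (∀ a → a ∈ x → a < γ)
    countable⇒bounded x (e , _ , _ , e-onto) = let γ , e<γ = bounded e in
      γ , λ a a∈x → let n , _ , en≡a = e-onto a a∈x in subst (_< γ) en≡a (e<γ n)

    countable⇒bounded-in-ω₁ : (x : Pred K ℓ) → U {A = ℕ} ≃ x →
                              ∃[ δ ] δ < ω₁ × (∀ ξ → ξ ∈ x → ξ < ω₁ → ξ < δ)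
    countable⇒bounded-in-ω₁ x (e , _ , _ , e-onto) =
      let δ , δ<ω₁ , s<δ = ω₁-bounded (λ n → truncate (e n)) (λ n → truncate<ω₁ (e n)) in
      δ , δ<ω₁ , λ ξ ξ∈x ξ<ω₁ → let n , _ , en≡ξ = e-onto ξ ξ∈x in
        subst (_< δ) (truncate-id ξ<ω₁) (subst (λ ζ → truncate ζ < δ) en≡ξ (s<δ n))
      where
      truncate : K → K
      truncate ξ with ξ <? ω₁
      ... | yes _ = ξ
      ... | no _  = 0ᵏ

      truncate<ω₁ : ∀ ξ → truncate ξ < ω₁
      truncate<ω₁ ξ with ξ <? ω₁
      ... | yes ξ<ω₁ = ξ<ω₁
      ... | no _     = proj₂ ω₁-nonempty

      truncate-id : ∀ {ξ} → ξ < ω₁ → truncate ξ ≡ ξ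
      truncate-id {ξ} ξ<ω₁ with ξ <? ω₁
      ... | yes _ = refl
      ... | no ≮  = contradiction ξ<ω₁ ≮

    ≃-respˡ-≐ : {x y : Pred K ℓ} → x ≐ y → U {A = ℕ} ≃ x → U {A = ℕ} ≃ y
    ≃-respˡ-≐ (x⊆y , y⊆x) (e , e∈ , e-inj , e-onto) =
      e , (λ n u → x⊆y (e∈ n u)) , e-inj , λ a a∈y → e-onto a (y⊆x a∈y)

    ⋃-countable : (x : ℕ → Pred K ℓ) → (∀ n → U {A = ℕ} ≃ x n) → U {A = ℕ} ≃ (⋃[ n ∶ ℕ ] x n)
    ⋃-countable x count = enumerable⇒ℕ≃ e (e∈ , e-onto)
        (proj₁ (count 0)) (λ n → 0 , proj₁ (proj₂ (count 0)) n tt)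
        (proj₁ (proj₂ (proj₂ (count 0))) tt tt)
      where
      e : ℕ → K
      e k = let m , n = unpair k in proj₁ (count m) n

      e∈ : ∀ k → e k ∈ (⋃[ n ∶ ℕ ] x n)
      e∈ k = let m , n = unpair k in m , proj₁ (proj₂ (count m)) n tt

      e-onto : ∀ a → a ∈ (⋃[ n ∶ ℕ ] x n) → ∃[ k ] e k ≡ a
      e-onto a (m , a∈) = let n , _ , eq = proj₂ (proj₂ (proj₂ (count m))) a a∈ in
        pair m n , trans (cong (λ p → proj₁ (count (proj₁ p)) (proj₂ p)) (unpair-pair m n)) eq

    insert : K → Pred K ℓ → Pred K ℓ
    insert β x a = a ≡ β ⊎ a ∈ x

    insert-countable : ∀ β {x} → U {A = ℕ} ≃ x → U {A = ℕ} ≃ insert β x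
    insert-countable β {x} (e , e∈ , e-inj , e-onto) =
      enumerable⇒ℕ≃ e′ (e′∈ , e′-onto) e (λ n → inj₂ (e∈ n tt)) (e-inj tt tt)
      where
      e′ : ℕ → K
      e′ zero   = β
      e′ (1+ n) = e n

      e′∈ : ∀ n → e′ n ∈ insert β x
      e′∈ zero   = inj₁ refl
      e′∈ (1+ n) = inj₂ (e∈ n tt)

      e′-onto : ∀ a → a ∈ insert β x → ∃[ n ] e′ n ≡ a
      e′-onto a (inj₁ refl) = 0 , refl
      e′-onto a (inj₂ a∈x)  = let n , _ , eq = e-onto a a∈x in 1+ n , eq

    ω-countable : U {A = ℕ} ≃ Range ω
    ω-countable = ω , (λ n _ → lift (n , refl)) , (λ _ _ → ω-injective) ,
                  λ { a (lift (n , eq)) → n , tt , eq }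

    -- The club of sets closed under countably many functions.

    ClosedUnder : (ℕ → K → K) → Pred K ℓ → Pred (Pred K ℓ) ℓ
    ClosedUnder f W x = (x ⊆ W × U {A = ℕ} ≃ x) × (∀ k a → a ∈ x → f k a ∈ x)

    module _ (f : ℕ → K → K) (W : Pred K ℓ) (f∈W : ∀ k a → a ∈ W → f k a ∈ W) where

      closedUnder-club : IsClubIn[ W ]^ℵ₀ (ClosedUnder f W)
      closedUnder-club = respects , proj₁ , unbounded , closed
        where
        respects : ∀ {x y} → x ≐ y → x ∈ ClosedUnder f W → y ∈ ClosedUnder f W
        respects x≐y ((x⊆W , count) , cl) =
          ((λ a∈y → x⊆W (proj₂ x≐y a∈y)) , ≃-respˡ-≐ x≐y count) ,
          λ k a a∈y → proj₁ x≐y (cl k a (proj₂ x≐y a∈y))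

        closed : ∀ (x : ℕ → Pred K ℓ) → (∀ n → x n ∈ ClosedUnder f W) →
                 (∀ n → x n ⊆ x (1+ n)) → (⋃[ n ∶ ℕ ] x n) ∈ ClosedUnder f W
        closed x x∈ _ =
          ((λ { (n , a∈) → proj₁ (proj₁ (x∈ n)) a∈ }) , ⋃-countable x (λ n → proj₂ (proj₁ (x∈ n)))) ,
          λ { k a (n , a∈) → n , proj₂ (x∈ n) k a a∈ }

        unbounded : ∀ x → x ∈ [ W ]^ℵ₀ → ∃[ y ] y ∈ ClosedUnder f W × x ⊆ y
        unbounded x (x⊆W , e , e∈ , e-inj , e-onto) =
          y , (((λ { {a} (m , lift (n , eq)) → subst W eq (g∈W m n) }) ,
                enumerable⇒ℕ≃ h (h∈ , h-onto) e (λ n → 0 , lift (n , refl)) (e-inj tt tt)) ,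
               y-closed) ,
          λ {a} a∈x → let n , _ , eq = e-onto a a∈x in 0 , lift (n , eq)
          where
          -- `g m` lists what `m` successive applications of the functions produce from x.
          g : ℕ → ℕ → K
          g zero   n = e n
          g (1+ m) n = let k , n′ = unpair n in f k (g m n′)

          y : Pred K ℓ
          y = ⋃[ m ∶ ℕ ] Range (g m)

          g∈W : ∀ m n → g m n ∈ W
          g∈W zero   n = x⊆W (e∈ n tt)
          g∈W (1+ m) n = f∈W _ _ (g∈W m _)

          h : ℕ → K
          h n = let m , n′ = unpair n in g m n′

          h∈ : ∀ n → h n ∈ y
          h∈ n = let m , n′ = unpair n in m , lift (n′ , refl)

          h-onto : ∀ a → a ∈ y → ∃[ n ] h n ≡ a
          h-onto a (m , lift (n , eq)) =
            pair m n , trans (cong (λ p → g (proj₁ p) (proj₂ p)) (unpair-pair m n)) eq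

          y-closed : ∀ k a → a ∈ y → f k a ∈ y
          y-closed k a (m , lift (n , refl)) = 1+ m , lift (pair k n ,
            cong (λ p → f (proj₁ p) (g m (proj₂ p))) (unpair-pair k n))

    IsSup-≐ : ∀ {p q} {A : Pred K p} {B : Pred K q} {α} → A ≐ B → IsSup A α → IsSup B α
    IsSup-≐ (A⊆B , B⊆A) (upper , min) =
      (λ b b∈B → upper b (B⊆A b∈B)) , λ τ le → min τ λ a a∈A → le a (A⊆B a∈A)

    acc-mono : ∀ {p q} {A : Pred K p} {B : Pred K q} → A ⊆ B → acc A ⊆ acc B
    acc-mono A⊆B (α∈A , (upper , min) , pos) =
      A⊆B α∈A ,
      ((λ b b∈ → inj₁ (proj₂ b∈)) , λ τ le → min τ λ a (a∈A , a<α) → le a (A⊆B a∈A , a<α)) ,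
      pos

    acc-∩↓ : ∀ {p} {A : Pred K p} {α β} → α ∈ acc A → α < β → α ∈ acc (A ∩ ↓ β)
    acc-∩↓ (α∈A , sup , pos) α<β =
      (α∈A , α<β) ,
      IsSup-≐ ((λ (a∈A , a<α) → (a∈A , <-trans a<α α<β) , a<α) , λ ((a∈A , _) , a<α) → a∈A , a<α) sup ,
      pos

    -- The square sequence and the relation `◁`.

    module _ (square : ⊟ κ ω₁) where

      open ⊟ square

      -- Such a limit has cofinality other than ω₁, so `acc-cof≢θ⊆Γ` applies.
      lub∈Γ : {s : ℕ → K} → (∀ n → s n < s (1+ n)) → ∀ {γ} → IsStrictSup (Range s) γ → γ ∈ Γ
      lub∈Γ s-inc {γ} γ-sup =
        acc-cof≢θ⊆Γ γ (lub∈acc s-inc γ-sup) (lub-cofinality s-inc γ-sup)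

      Γ-unbounded : ∀ β → ∃[ γ ] γ ∈ Γ × β < γ
      Γ-unbounded β = proj₁ γ , lub∈Γ inc (proj₂ γ) , s<lub inc (proj₂ γ) 0
        where
        s : ℕ → K
        s zero   = β
        s (1+ n) = proj₁ (above (s n))

        inc : ∀ n → s n < s (1+ n)
        inc n = proj₂ (above (s n))

        γ = lub s

      infix 4 _◁[_]_
      _◁[_]_ : K → K → K → Set ℓ
      η ◁[ i ] α = i₀ α ≤ i × η ∈ acc (C α i)

      ◁-mono : ∀ {η α i j} → α ∈ Γ → i ≤ j → j < ω₁ → η ◁[ i ] α → η ◁[ j ] α
      ◁-mono α∈Γ i≤j j<ω₁ (i₀≤i , η∈) =
        ≤-trans i₀≤i i≤j , acc-mono (increasing _ _ _ α∈Γ i₀≤i i≤j j<ω₁) η∈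

      -- By coherence `C β i` is `C α i ∩ ↓ β`, and cutting at β keeps the accumulation points below
      -- β.
      ◁-cancel : ∀ {η β α i} → α ∈ Γ → i < ω₁ → η < β → η ◁[ i ] α → β ◁[ i ] α → η ◁[ i ] β
      ◁-cancel {η} {β} {α} {i} α∈Γ i<ω₁ η<β (i₀≤i , η∈) (_ , β∈) =
        i₀-coherent α i β α∈Γ i₀≤i i<ω₁ β∈ ,
        acc-mono (proj₂ (C-coherent α i β α∈Γ i₀≤i i<ω₁ β∈)) (acc-∩↓ η∈ η<β)

      ◁-exists : ∀ {η α} → α ∈ Γ → η ∈ Γ → η < α → ∃[ i ] i < ω₁ × η ◁[ i ] α
      ◁-exists {η} {α} α∈Γ η∈Γ η<α with proj₁ (covering α α∈Γ) (η∈Γ , η<α)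
      ... | i , i₀≤i , i<ω₁ , η∈ = i , i<ω₁ , i₀≤i , η∈

      -- ⊑* does not ask x ⊆ y, so membership may depend on x only through x ∩ ω₁
      -- and ssup x.
      Bad : K → Pred (Pred K ℓ) ℓ
      Bad η x = x ∈ [ U ]^ℵ₀ × ∃[ α ] ∃[ δ ]
        IsSsup x α × α ∈ Γ × η < α × δ < ω₁ × (∀ ξ → ξ ∈ x → ξ < ω₁ → ξ < δ) × ¬ (η ◁[ δ ] α)

      Bad-respects : ∀ η {x y} → x ≐ y → x ∈ Bad η → y ∈ Bad η
      Bad-respects η x≐y@(_ , y⊆x) ((_ , count) , α , δ , sup , α∈Γ , η<α , δ<ω₁ , x<δ , ¬◁) =
        ((λ _ → tt) , ≃-respˡ-≐ x≐y count) , α , δ ,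
        IsSup-≐ ((λ (a , a∈ , a⋖) → a , proj₁ x≐y a∈ , a⋖) , λ (a , a∈ , a⋖) → a , y⊆x a∈ , a⋖) sup ,
        α∈Γ , η<α , δ<ω₁ , (λ ξ ξ∈y → x<δ ξ (y⊆x ξ∈y)) , ¬◁

      Bad-upward : ∀ η x y → x ∈ Bad η → y ∈ [ U ]^ℵ₀ → ⊑* ω₁ x y → y ∈ Bad η
      Bad-upward η x y (_ , α , δ , sup , α∈Γ , η<α , δ<ω₁ , x<δ , ¬◁) y∈
                 ((_ , y∩ω₁⊆) , (σ , σ-x , σ-y) , _) =
        y∈ , α , δ , subst (IsSsup y) (IsSsup-unique σ-x sup) σ-y , α∈Γ , η<α , δ<ω₁ ,
        (λ ξ ξ∈y ξ<ω₁ → x<δ ξ (proj₁ (y∩ω₁⊆ (ξ∈y , ξ<ω₁))) ξ<ω₁) , ¬◁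

      -- Non-reflection of `Bad η` to sets of size ℵ₁.

      module _ (η : K) (η∈Γ : η ∈ Γ) (W : Pred K ℓ) (ω₁≃W : ↓ ω₁ ≃ W) (ω₁⊆W : ↓ ω₁ ⊆ W) where

        W-bounded : ∃[ γ ] (∀ w → w ∈ W → w < γ)
        W-bounded = let h , _ , _ , h-onto = ω₁≃W
                        γ , h<γ = bounded-on ω₁ h
                    in γ , λ w w∈W → let ξ , ξ<ω₁ , eq = h-onto w w∈W in
                         subst (_< γ) eq (h<γ ξ ξ<ω₁)

        -- The bound γ < α of `W` keeps strict suprema of subsets of `W` below α.
        limitAbove : ∃[ α ] α ∈ Γ × η < α × (∃[ γ ] γ < α × (∀ w → w ∈ W → w < γ))
        limitAbove =
          let γ , W<γ = W-bounded
              β , η<β , γ<β = upper₂ η γ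
              α , α∈Γ , β<α = Γ-unbounded β
          in α , α∈Γ , <-trans η<β β<α , γ , <-trans γ<β β<α , W<γ

        module _ (max : K) (max∈W : max ∈ W) (W≤max : ∀ w → w ∈ W → w ≤ max) where

          -- Closure under the constant function puts `max` into x. The strict supremum of x is then
          -- the successor of `max`, whereas elements of Γ are limits.
          max-club-avoids-Bad : ∀ x → x ∈ ClosedUnder (λ _ _ → max) W → ¬ x ∈ Bad η
          max-club-avoids-Bad x ((x⊆W , e , e∈ , _) , cl) (_ , α , δ , sup , α∈Γ , _) =
            <⇒≱ (proj₁ strict max (cl 0 (e 0) (e∈ 0 tt)))
                (proj₂ (proj₁ (proj₂ (Γ⊆acc α∈Γ))) max λ a (_ , a<α) →
                  ≮⇒≥ λ max<a → <⇒≱ a<α (proj₂ strict a λ b b∈x →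
                    ≤-<-trans (W≤max b (x⊆W b∈x)) max<a))
            where
            strict : IsStrictSup x α
            strict = IsSsup⇒IsStrictSup sup

        module _ (noMax : ∀ w → w ∈ W → ∃[ v ] v ∈ W × w < v) where

          α* : K
          α* = proj₁ limitAbove

          α*∈Γ : α* ∈ Γ
          α*∈Γ = proj₁ (proj₂ limitAbove)

          Interpolated : K → K → K → Set ℓ
          Interpolated w j v = j < ω₁ × v ∈ W × i₀ α* ≤ j × ∃[ γ ] γ ∈ C α* j × w ≤ γ × γ < v

          -- An increasing sequence in `W` starting at w has its limit in Γ below `α*`, so by
          -- `covering` the limit accumulates some `C α* j`. This club has a point between w and the
          -- limit, and the sequence passes it.
          interpolate : ∀ w → w ∈ W → ∃[ j ] ∃[ v ] Interpolated w j v
          interpolate w w∈W =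
            let η<α* , β , β<α* , W<β = proj₂ (proj₂ limitAbove)
                γ<α* = ≤-<-trans (proj₂ γ-sup β λ { _ (lift (n , refl)) → W<β _ (s∈W n) }) β<α*
                j , j<ω₁ , i₀≤j , γ∈C , (_ , C-cofinal) , _ = ◁-exists α*∈Γ (lub∈Γ inc γ-sup) γ<α*
                c , c∈C , w≤c , c<γ = stable λ none → <⇒≱ (s<lub inc γ-sup 0)
                  (C-cofinal w λ a (a∈C , a<γ) → inj₁ (≰⇒> λ w≤a → none (a , a∈C , w≤a , a<γ)))
                n , c≤sn = below-lub inc γ-sup c<γ
            in j , s (1+ n) , j<ω₁ , s∈W (1+ n) , i₀≤j , c , c∈C , w≤c , ≤-<-trans c≤sn (inc n)
            where
            chain : ℕ → ∃[ v ] v ∈ W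
            chain zero   = w , w∈W
            chain (1+ n) = let v , v∈W = chain n
                               v′ , v′∈W , _ = noMax v v∈W in v′ , v′∈W

            s : ℕ → K
            s n = proj₁ (chain n)

            s∈W : ∀ n → s n ∈ W
            s∈W n = proj₂ (chain n)

            inc : ∀ n → s n < s (1+ n)
            inc n = let v , v∈W = chain n in proj₂ (proj₂ (noMax v v∈W))

            γ = proj₁ (lub s)
            γ-sup = proj₂ (lub s)

          j* : ∃[ j ] j < ω₁ × η ◁[ j ] α*
          j* = ◁-exists α*∈Γ η∈Γ (proj₁ (proj₂ (proj₂ limitAbove)))

          jump : K → K × K
          jump w with dec (∃[ j ] ∃[ v ] Interpolated w j v)
          ... | yes (j , v , _) = j , v
          ... | no _            = 0ᵏ , 0ᵏ

          jump-spec : ∀ w → w ∈ W → Interpolated w (proj₁ (jump w)) (proj₂ (jump w))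
          jump-spec w w∈W with dec (∃[ j ] ∃[ v ] Interpolated w j v)
          ... | yes (_ , _ , p) = p
          ... | no none         = contradiction (interpolate w w∈W) none

          -- Closed sets contain, as countable ordinals, the levels used to interpolate above their
          -- members, and `j*` too. Any δ above their trace on ω₁ therefore exceeds all these
          -- levels.
          closure : ℕ → K → K
          closure 0 w      = proj₁ (jump w)
          closure 1 w      = proj₂ (jump w)
          closure (1+ (1+ _)) _ = proj₁ j*

          closure∈W : ∀ k w → w ∈ W → closure k w ∈ W
          closure∈W 0 w w∈W           = ω₁⊆W (proj₁ (jump-spec w w∈W))
          closure∈W 1 w w∈W           = proj₁ (proj₂ (jump-spec w w∈W))
          closure∈W (1+ (1+ _)) w w∈W = ω₁⊆W (proj₁ (proj₂ j*))

          closure-club-avoids-Bad : ∀ x → x ∈ ClosedUnder closure W → ¬ x ∈ Bad η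
          closure-club-avoids-Bad x ((x⊆W , e , e∈ , _) , cl)
                                  (_ , α , δ , sup , α∈Γ , η<α , δ<ω₁ , x<δ , ¬◁) =
            ¬◁ (◁-cancel α*∈Γ δ<ω₁ η<α η◁α* α◁α*)
            where
            strict : IsStrictSup x α
            strict = IsSsup⇒IsStrictSup sup

            α<α* : α < α*
            α<α* = let _ , β , β<α* , W<β = proj₂ (proj₂ limitAbove) in
              ≤-<-trans (proj₂ strict β λ a a∈x → W<β a (x⊆W a∈x)) β<α*

            η◁α* : η ◁[ δ ] α*
            η◁α* = let j , j<ω₁ , η◁ = j* in
              ◁-mono α*∈Γ (inj₁ (x<δ j (cl 2 (e 0) (e∈ 0 tt)) j<ω₁)) δ<ω₁ η◁

            C-meets : ∀ a → a ∈ x → ∃[ γ ] γ ∈ C α* δ × a ≤ γ × γ < α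
            C-meets a a∈x =
              let j<ω₁ , _ , i₀≤j , γ , γ∈C , a≤γ , γ<v = jump-spec a (x⊆W a∈x) in
              γ , increasing α* _ δ α*∈Γ i₀≤j (inj₁ (x<δ _ (cl 0 a a∈x) j<ω₁)) δ<ω₁ γ∈C ,
              a≤γ , <-trans γ<v (proj₁ strict _ (cl 1 a a∈x))

            -- Two interpolations are chained: one gives only a ≤ τ, while the strict supremum calls
            -- for a < τ.
            C-cofinal : IsSup (C α* δ ∩ ↓ α) α
            C-cofinal = (λ _ (_ , a<α) → inj₁ a<α) , λ τ le → proj₂ strict τ λ a a∈x →
              let _ , _ , _ , _ , _ , a≤γ , γ<v = jump-spec a (x⊆W a∈x)
                  γ′ , γ′∈C , v≤γ′ , γ′<α = C-meets _ (cl 1 a a∈x)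
              in <-≤-trans (≤-<-trans a≤γ γ<v) (≤-trans v≤γ′ (le γ′ (γ′∈C , γ′<α)))

            α◁α* : α ◁[ δ ] α*
            α◁α* = let i₀≤δ = proj₁ η◁α* in
              i₀≤δ ,
              proj₂ (proj₂ (club α* δ α*∈Γ i₀≤δ δ<ω₁)) α α<α* (η , η<α) C-cofinal ,
              C-cofinal , η , η<α

        Bad-nonreflecting : ¬ IsStationaryIn[ W ]^ℵ₀ (Bad η)
        Bad-nonreflecting stationary with dec (∃[ w ] w ∈ W × (∀ v → v ∈ W → v ≤ w))
        ... | yes (max , max∈W , W≤max) =
          let x , x∈Bad , x∈club = stationary _ (closedUnder-club (λ _ _ → max) W λ _ _ _ → max∈W) in
          max-club-avoids-Bad max max∈W W≤max x x∈club x∈Bad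
        ... | no none =
          let x , x∈Bad , x∈club = stationary _ (closedUnder-club (closure noMax) W (closure∈W noMax)) in
          closure-club-avoids-Bad noMax x x∈club x∈Bad
          where
          noMax : ∀ w → w ∈ W → ∃[ v ] v ∈ W × w < v
          noMax w w∈W = stable λ ¬p → none (w , w∈W , λ v v∈W → ≮⇒≥ λ w<v → ¬p (v , v∈W , w<v))

      -- The game played inside a club of countable sets.

      -- The closed game in which the players alternately choose ξ and β > ξ; a
      -- position is the list of the β's, latest first.  The second player has to
      -- keep G l ∩ ω₁ below δ.  Every δ ≥ ω₁ counts as lost, so that strategies
      -- can be indexed by all of K.
      module Game (𝒞 : Pred (Pred K ℓ) ℓ) (𝒞-club : IsClubIn[ U ]^ℵ₀ 𝒞) where

        private
          𝒞-countable : ∀ x → x ∈ 𝒞 → U {A = ℕ} ≃ x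
          𝒞-countable x x∈𝒞 = proj₂ (proj₁ (proj₂ 𝒞-club) x∈𝒞)

          cofinal = proj₁ (proj₂ (proj₂ 𝒞-club))
          chain-closed = proj₂ (proj₂ (proj₂ 𝒞-club))

          -- Unboundedness of 𝒞 absorbs each played β into a larger member; `Range ω` serves as a
          -- countable set to start from.
          member : List K → ∃[ x ] x ∈ 𝒞
          member [] = let x , x∈𝒞 , _ = cofinal (Range ω) ((λ _ → tt) , ω-countable) in x , x∈𝒞
          member (β ∷ l) =
            let x , x∈𝒞 = member l
                y , y∈𝒞 , _ = cofinal (insert β x)
                                 ((λ _ → tt) , insert-countable β (𝒞-countable x x∈𝒞))
            in y , y∈𝒞

        G : List K → Pred K ℓ
        G l = proj₁ (member l)

        G∈𝒞 : ∀ l → G l ∈ 𝒞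
        G∈𝒞 l = proj₂ (member l)

        G-∷ : ∀ β l → insert β (G l) ⊆ G (β ∷ l)
        G-∷ β l = proj₂ (proj₂ (cofinal (insert β (G l))
          ((λ _ → tt) , insert-countable β (𝒞-countable (G l) (G∈𝒞 l)))))

        ⋃G∈𝒞 : (l : ℕ → List K) (β : ℕ → K) → (∀ n → l (1+ n) ≡ β n ∷ l n) →
               (⋃[ n ∶ ℕ ] G (l n)) ∈ 𝒞
        ⋃G∈𝒞 l β l-step = chain-closed (λ n → G (l n)) (λ n → G∈𝒞 (l n))
          λ n {a} a∈ → subst (λ m → a ∈ G m) (sym (l-step n)) (G-∷ (β n) (l n) (inj₂ a∈))

        G-bounded : ∀ l → ∃[ γ ] (∀ a → a ∈ G l → a < γ)
        G-bounded l = countable⇒bounded (G l) (𝒞-countable (G l) (G∈𝒞 l))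

        Lost : K → List K → Set ℓ
        Lost δ l = ω₁ ≤ δ ⊎ ∃[ ξ ] ξ ∈ G l × ξ < ω₁ × δ ≤ ξ

        -- The first player can win only at a finite stage, so a winning strategy is a well-founded
        -- tree whose leaves are losses of the second player.
        data FirstWins (δ : K) (l : List K) : Set ℓ where
          now   : Lost δ l → FirstWins δ l
          later : (ξ : K) → (∀ β → ξ < β → FirstWins δ (β ∷ l)) → FirstWins δ l

        firstMove : ∀ {δ l} → FirstWins δ l → K
        firstMove (now _)     = 0ᵏ
        firstMove (later ξ _) = ξ

        -- A loss persists because `G` grows along a play. The first move is bounded for δ < ω₁
        -- only, as in `reply`; every other δ is lost outright.
        advance : ∀ {δ l} β (t : FirstWins δ l) → (δ < ω₁ → firstMove t < β) → FirstWins δ (β ∷ l)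
        advance β (now (inj₁ ω₁≤δ)) _ = now (inj₁ ω₁≤δ)
        advance {l = l} β (now (inj₂ (ξ , ξ∈ , p))) _ = now (inj₂ (ξ , G-∷ β l (inj₂ ξ∈) , p))
        advance {δ} β (later ξ k) ξ<β with δ <? ω₁
        ... | yes δ<ω₁ = k β (ξ<β δ<ω₁)
        ... | no δ≮ω₁  = now (inj₁ (≮⇒≥ δ≮ω₁))

        record Position : Set ℓ where
          constructor _∥_
          field
            played   : List K
            strategy : ∀ δ → FirstWins δ played

        open Position

        reply : ∀ p → ∃[ β ] (∀ δ → δ < ω₁ → firstMove (strategy p δ) < β)
        reply p = bounded-on ω₁ (λ δ → firstMove (strategy p δ))

        next : Position → Position
        next p = let β , moves<β = reply p in
          (β ∷ played p) ∥ λ δ → advance β (strategy p δ) (moves<β δ)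

        run : ℕ → Position → Position
        run zero   p = p
        run (1+ n) p = run n (next p)

        -- `run` makes its first move outermost, which fits the descent through the strategy trees;
        -- chains of members of 𝒞 need the last move exposed instead.
        next-run : ∀ n p → played (run (1+ n) p) ≡ proj₁ (reply (run n p)) ∷ played (run n p)
        next-run zero   p = refl
        next-run (1+ n) p = next-run n (next p)

        -- The strategies for all δ are followed simultaneously, so descending
        -- in the tree for δ must end in a loss at δ.
        run-lost : ∀ δ p (t : FirstWins δ (played p)) → strategy p δ ≡ t →
                   ∃[ n ] Lost δ (played (run n p))
        run-lost δ p (now lost) _ = 0 , lost
        run-lost δ p (later ξ k) eq with δ <? ω₁
        ... | no δ≮ω₁ = 0 , inj₁ (≮⇒≥ δ≮ω₁)
        ... | yes δ<ω₁ =
          let β , moves<β = reply p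
              ξ<β , eq′ = step β (strategy p δ) (moves<β δ) eq
              n , lost = run-lost δ (next p) (k β ξ<β) eq′
          in 1+ n , lost
          where
          step : ∀ β (t : FirstWins δ (played p)) (t<β : δ < ω₁ → firstMove t < β) →
                 t ≡ later ξ k → ∃[ ξ<β ] advance β t t<β ≡ k β ξ<β
          step β _ t<β refl with δ <? ω₁
          ... | yes q = t<β q , refl
          ... | no ≮  = contradiction δ<ω₁ ≮

        second-survives : ∃[ δ ] ¬ FirstWins δ []
        second-survives with dec (∃[ δ ] ¬ FirstWins δ [])
        ... | yes p = p
        ... | no none = let n , lost = run-lost δ start (strategy start δ) refl in ⊥-elim (survived n lost)
          where
          start : Position
          start = [] ∥ λ δ → stable λ ¬t → none (δ , ¬t)

          l : ℕ → List K
          l n = played (run n start)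

          x : Pred K ℓ
          x = ⋃[ n ∶ ℕ ] G (l n)

          -- This δ is found after the play: the union of the members built is again in 𝒞, hence
          -- countable, so its trace on ω₁ is bounded.
          bound = countable⇒bounded-in-ω₁ x (𝒞-countable x
                    (⋃G∈𝒞 l (λ n → proj₁ (reply (run n start))) (λ n → next-run n start)))
          δ = proj₁ bound

          survived : ∀ n → ¬ Lost δ (l n)
          survived n (inj₁ ω₁≤δ) = <⇒≱ (proj₁ (proj₂ bound)) ω₁≤δ
          survived n (inj₂ (ξ , ξ∈ , ξ<ω₁ , δ≤ξ)) =
            <⇒≱ (proj₂ (proj₂ bound) ξ (n , ξ∈) ξ<ω₁) δ≤ξ

        survivor-moves : ∀ {δ l} → ¬ FirstWins δ l → ∀ ξ → ∃[ β ] ξ < β × ¬ FirstWins δ (β ∷ l)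
        survivor-moves ¬t ξ = stable λ none →
          ¬t (later ξ λ β ξ<β → stable λ ¬t′ → none (β , ξ<β , ¬t′))

        survivor-trace : ∀ {δ l} → ¬ FirstWins δ l → ∀ ξ → ξ ∈ G l → ξ < ω₁ → ξ < δ
        survivor-trace ¬t ξ ξ∈ ξ<ω₁ = ≰⇒> λ δ≤ξ → ¬t (now (inj₂ (ξ , ξ∈ , ξ<ω₁ , δ≤ξ)))

        survivor<ω₁ : ∀ {δ l} → ¬ FirstWins δ l → δ < ω₁
        survivor<ω₁ ¬t = ≰⇒> λ ω₁≤δ → ¬t (now (inj₁ ω₁≤δ))

      -- Comparing elements of Γ that share a δ.

      Homogeneous : K → K → Set (suc ℓ)
      Homogeneous δ η = η ∈ Γ × ∃[ 𝒞 ] ∃[ 𝒞-club ]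
        (∀ x → x ∈ 𝒞 → ¬ x ∈ Bad η) × ¬ Game.FirstWins 𝒞 𝒞-club δ []

      homogeneous<ω₁ : ∀ {δ η} → Homogeneous δ η → δ < ω₁
      homogeneous<ω₁ (_ , 𝒞 , 𝒞-club , _ , ¬t) = Game.survivor<ω₁ 𝒞 𝒞-club ¬t

      -- Two plays are interleaved so that the resulting members of the two clubs
      -- have the same supremum.
      homogeneous-pair : ∀ {δ η η′} → Homogeneous δ η → Homogeneous δ η′ → η < η′ → η ◁[ δ ] η′
      homogeneous-pair {δ} {η} {η′} h@(_ , 𝒞 , 𝒞-club , avoids , ¬t)
                       (_ , 𝒞′ , 𝒞′-club , avoids′ , ¬t′) η<η′ =
        ◁-cancel α∈Γ δ<ω₁ η<η′
          -- If `η ◁[ δ ] α` failed, x would be a member of 𝒞 in `Bad η`, as survival keeps its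
          -- trace on ω₁ below δ.
          (stable λ ¬◁ → avoids x (A.⋃G∈𝒞 l β λ _ → refl)
            (((λ _ → tt) , ⋃-countable _ λ n → proj₂ (proj₁ (proj₂ 𝒞-club) (A.G∈𝒞 (l n)))) , α , δ ,
             IsStrictSup⇒IsSsup x-sup , α∈Γ , <-trans η<η′ η′<α , δ<ω₁ ,
             (λ ξ (n , ξ∈) → A.survivor-trace (left-survives (play n)) ξ ξ∈) , ¬◁))
          (stable λ ¬◁ → avoids′ x′ (B.⋃G∈𝒞 l′ β′ λ _ → refl)
            (((λ _ → tt) , ⋃-countable _ λ n → proj₂ (proj₁ (proj₂ 𝒞′-club) (B.G∈𝒞 (l′ n)))) , α , δ ,
             IsStrictSup⇒IsSsup x′-sup , α∈Γ , η′<α , δ<ω₁ ,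
             (λ ξ (n , ξ∈) → B.survivor-trace (right-survives (play n)) ξ ξ∈) , ¬◁))
        where
        module A = Game 𝒞 𝒞-club
        module B = Game 𝒞′ 𝒞′-club

        δ<ω₁ : δ < ω₁
        δ<ω₁ = homogeneous<ω₁ h

        record Interleaving : Set ℓ where
          constructor interleaving
          field
            {left right} : List K
            left-survives  : ¬ A.FirstWins δ left
            right-survives : ¬ B.FirstWins δ right

          -- In both games the same ξ is answered, chosen above everything built in either, so both
          -- unions get the supremum of the ξ's.
          limit : ∃[ ξ ] η′ < ξ × (∀ a → a ∈ A.G left → a < ξ) × (∀ a → a ∈ B.G right → a < ξ)
          limit =
            let γ , left<γ   = A.G-bounded left
                γ′ , right<γ′ = B.G-bounded right
                ζ , γ<ζ , γ′<ζ = upper₂ γ γ′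
                ξ , η′<ξ , ζ<ξ = upper₂ η′ ζ
            in ξ , η′<ξ , (λ a a∈ → <-trans (<-trans (left<γ a a∈) γ<ζ) ζ<ξ) ,
                          (λ a a∈ → <-trans (<-trans (right<γ′ a a∈) γ′<ζ) ζ<ξ)

          moveₗ = A.survivor-moves left-survives (proj₁ limit)
          moveᵣ = B.survivor-moves right-survives (proj₁ limit)

        open Interleaving

        play : ℕ → Interleaving
        play zero   = interleaving ¬t ¬t′
        play (1+ n) = interleaving (proj₂ (proj₂ (moveₗ (play n)))) (proj₂ (proj₂ (moveᵣ (play n))))

        l l′ : ℕ → List K
        l n  = left (play n)
        l′ n = right (play n)

        β β′ ξ : ℕ → K
        β n  = proj₁ (moveₗ (play n))
        β′ n = proj₁ (moveᵣ (play n))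
        ξ n  = proj₁ (limit (play n))

        x x′ : Pred K ℓ
        x  = ⋃[ n ∶ ℕ ] A.G (l n)
        x′ = ⋃[ n ∶ ℕ ] B.G (l′ n)

        β∈ : ∀ n → β n ∈ A.G (l (1+ n))
        β∈ n = A.G-∷ (β n) (l n) (inj₁ refl)

        β′∈ : ∀ n → β′ n ∈ B.G (l′ (1+ n))
        β′∈ n = B.G-∷ (β′ n) (l′ n) (inj₁ refl)

        ξ<β : ∀ n → ξ n < β n
        ξ<β n = proj₁ (proj₂ (moveₗ (play n)))

        ξ<β′ : ∀ n → ξ n < β′ n
        ξ<β′ n = proj₁ (proj₂ (moveᵣ (play n)))

        ξ-increasing : ∀ n → ξ n < ξ (1+ n)
        ξ-increasing n = <-trans (ξ<β n)
          (proj₁ (proj₂ (proj₂ (limit (play (1+ n))))) (β n) (β∈ n))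

        α = proj₁ (lub ξ)
        α-sup = proj₂ (lub ξ)

        α∈Γ : α ∈ Γ
        α∈Γ = lub∈Γ ξ-increasing α-sup

        ξ<α : ∀ n → ξ n < α
        ξ<α = s<lub ξ-increasing α-sup

        η′<α : η′ < α
        η′<α = <-trans (proj₁ (proj₂ (limit (play 0)))) (ξ<α 0)

        x-sup : IsStrictSup x α
        x-sup =
          (λ a (n , a∈) → <-trans (proj₁ (proj₂ (proj₂ (limit (play n)))) a a∈) (ξ<α n)) ,
          λ τ x<τ → proj₂ α-sup τ
            λ { _ (lift (n , refl)) → <-trans (ξ<β n) (x<τ (β n) (1+ n , β∈ n)) }

        x′-sup : IsStrictSup x′ α
        x′-sup =
          (λ a (n , a∈) → <-trans (proj₂ (proj₂ (proj₂ (limit (play n)))) a a∈) (ξ<α n)) ,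
          λ τ x<τ → proj₂ α-sup τ
            λ { _ (lift (n , refl)) → <-trans (ξ<β′ n) (x<τ (β′ n) (1+ n , β′∈ n)) }

      homogeneous-exists : (∀ η → η ∈ Γ → ¬ IsStationaryIn[ U ]^ℵ₀ (Bad η)) →
                           ∀ η → η ∈ Γ → ∃[ δ ] Homogeneous δ η
      homogeneous-exists nonstationary η η∈Γ
        with em {∃[ 𝒞 ] IsClubIn[ U ]^ℵ₀ 𝒞 × (∀ x → x ∈ 𝒞 → ¬ x ∈ Bad η)}
      ... | yes (𝒞 , 𝒞-club , avoids) = let δ , ¬t = Game.second-survives 𝒞 𝒞-club in
                                        δ , η∈Γ , 𝒞 , 𝒞-club , avoids , ¬t
      ... | no none = ⊥-elim (nonstationary η η∈Γ λ 𝒞 𝒞-club →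
              decidable-stable em λ disjoint →
                none (𝒞 , 𝒞-club , λ x x∈𝒞 x∈Bad → disjoint (x , x∈Bad , x∈𝒞)))

      -- Pigeonhole: otherwise each δ < ω₁ has a bound for its homogeneous η. By regularity some γ
      -- exceeds all these bounds, yet Γ has an element above γ, homogeneous for some δ < ω₁.
      homogeneous-unbounded : (∀ η → η ∈ Γ → ∃[ δ ] Homogeneous δ η) →
                              ∃[ δ ] (∀ γ → ∃[ η ] γ < η × Homogeneous δ η)
      homogeneous-unbounded exists = decidable-stable em λ none →
        let bounds = λ δ → escape λ unbounded → none (δ , unbounded)
            γ , bounds<γ = bounded-on ω₁ (λ δ → proj₁ (bounds δ))
            η , η∈Γ , γ<η = Γ-unbounded γ
            δ , h = exists η η∈Γ
        in proj₂ (bounds δ) η (<-trans (bounds<γ δ (homogeneous<ω₁ h)) γ<η) h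
        where
        escape : ∀ {δ} → ¬ (∀ γ → ∃[ η ] γ < η × Homogeneous δ η) →
                 ∃[ γ ] (∀ η → γ < η → ¬ Homogeneous δ η)
        escape ¬unbounded = decidable-stable em λ none → ¬unbounded λ γ →
          decidable-stable em λ ¬p → none (γ , λ η γ<η h → ¬p (η , γ<η , h))

      -- The club threading the square.

      module Thread (δ : K) (unbounded : ∀ γ → ∃[ η ] γ < η × Homogeneous δ η) where

        u : K → K
        u γ = proj₁ (unbounded γ)

        γ<u : ∀ γ → γ < u γ
        γ<u γ = proj₁ (proj₂ (unbounded γ))

        u-homogeneous : ∀ γ → Homogeneous δ (u γ)
        u-homogeneous γ = proj₂ (proj₂ (unbounded γ))

        u∈Γ : ∀ γ → u γ ∈ Γ
        u∈Γ γ = proj₁ (u-homogeneous γ)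

        δ<ω₁ : δ < ω₁
        δ<ω₁ = homogeneous<ω₁ (u-homogeneous 0ᵏ)

        -- Some larger homogeneous β has η in `acc (C β δ)`, and coherence bounds `i₀ η`.
        i₀≤δ : ∀ {η} → Homogeneous δ η → i₀ η ≤ δ
        i₀≤δ {η} h =
          let β , η<β , h′ = unbounded η
              i₀≤ , η∈ = homogeneous-pair h h′ η<β
          in i₀-coherent β δ η (proj₁ h′) i₀≤ δ<ω₁ η∈

        agree< : ∀ {η η′} → Homogeneous δ η → Homogeneous δ η′ → η < η′ →
                 C η δ ≐ (C η′ δ ∩ ↓ η)
        agree< h h′ η<η′ = let i₀≤ , η∈ = homogeneous-pair h h′ η<η′ in
          C-coherent _ δ _ (proj₁ h′) i₀≤ δ<ω₁ η∈

        agree : ∀ {η η′ γ} → Homogeneous δ η → Homogeneous δ η′ → γ < η → γ < η′ →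
                γ ∈ C η δ → γ ∈ C η′ δ
        agree {η} {η′} h h′ γ<η γ<η′ γ∈ with compare η η′
        ... | tri< η<η′ _ _ = proj₁ (proj₁ (agree< h h′ η<η′) γ∈)
        ... | tri≈ _ refl _ = γ∈
        ... | tri> _ _ η′<η = proj₂ (agree< h′ h η′<η) (γ∈ , γ<η′)

        -- By `agree` this is the union of `C η δ` over all homogeneous η. Going through the chosen
        -- `u γ` keeps it at level ℓ, while homogeneity quantifies over clubs and lives one level
        -- up.
        D : Pred K ℓ
        D γ = γ ∈ C (u γ) δ

        u-club : ∀ γ → IsClubIn (↓ (u γ)) (C (u γ) δ)
        u-club γ = club (u γ) δ (u∈Γ γ) (i₀≤δ (u-homogeneous γ)) δ<ω₁

        D≐C : ∀ {η γ} → Homogeneous δ η → γ < η → (D ∩ ↓ γ) ≐ (C η δ ∩ ↓ γ)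
        D≐C h γ<η =
          (λ {a} (a∈D , a<γ) → agree (u-homogeneous a) h (γ<u a) (<-trans a<γ γ<η) a∈D , a<γ) ,
          (λ {a} (a∈C , a<γ) → agree h (u-homogeneous a) (<-trans a<γ γ<η) (γ<u a) a∈C , a<γ)

        D-club : IsClubIn U D
        D-club = (λ _ → tt) , cofinal , closed
          where
          cofinal : ∀ β → β ∈ U → ∃[ γ ] γ ∈ D × β ≤ γ
          cofinal β _ =
            let γ , γ∈C , β≤γ = proj₁ (proj₂ (u-club β)) β (γ<u β)
            in γ , agree (u-homogeneous β) (u-homogeneous γ) (proj₁ (u-club β) γ∈C) (γ<u γ) γ∈C , β≤γ

          closed : ∀ γ → γ ∈ U → (∃[ β ] β < γ) → IsSup (D ∩ ↓ γ) γ → γ ∈ D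
          closed γ _ pos sup = proj₂ (proj₂ (u-club γ)) γ (γ<u γ) pos
            (IsSup-≐ (D≐C (u-homogeneous γ) (γ<u γ)) sup)

        -- Below α the sets `D` and `C (u α) δ` agree, so α accumulates the latter too; coherence
        -- then makes `C α δ` equal to `D ∩ ↓ α`.
        D-guessed : ¬ (∃[ α ] α ∈ acc D × α ∈ Γ ×
                         (∀ i → i₀ α ≤ i → i < ω₁ → ¬ ((D ∩ ↓ α) ≐ C α i)))
        D-guessed (α , (α∈D , sup , pos) , α∈Γ , differs) =
          differs δ (i₀-coherent (u α) δ α (u∈Γ α) i₀≤ δ<ω₁ α∈acc) δ<ω₁
            ((λ p → proj₂ Cα (proj₁ D≐ p)) , (λ p → proj₂ D≐ (proj₁ Cα p)))
          where
          D≐ = D≐C (u-homogeneous α) (γ<u α)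
          i₀≤ = i₀≤δ (u-homogeneous α)

          α∈acc : α ∈ acc (C (u α) δ)
          α∈acc = α∈D , IsSup-≐ D≐ sup , pos

          Cα = C-coherent (u α) δ α (u∈Γ α) i₀≤ δ<ω₁ α∈acc

      -- Contradiction with the nontriviality of the square.

      some-Bad-stationary : ¬ (∀ η → η ∈ Γ → ¬ IsStationaryIn[ U ]^ℵ₀ (Bad η))
      some-Bad-stationary nonstationary =
        let δ , unbounded = homogeneous-unbounded (homogeneous-exists nonstationary)
            open Thread δ unbounded
        in D-guessed (nontrivial D D-club)

theorem3p5 : (ℓ : Level) → ExcludedMiddle (suc ℓ) → SSR ℓ →
    (κ : Ordinal ℓ) (ω₁ : Ordinal.Carrier κ) →
    IsRegular κ → Isω₁ κ ω₁ → ω₂≤-given-ω₁ κ ω₁ → ¬ (⊟ κ ω₁)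
theorem3p5 ℓ em ssr κ ω₁ regular isω₁ ω₂≤κ square =
  some-Bad-stationary em κ regular ω₁ isω₁ square λ η η∈Γ stationary →
    let W , ω₁≃W , ω₁⊆W , reflects =
          ssr κ ω₁ regular isω₁ ω₂≤κ (Bad em κ regular ω₁ isω₁ square η)
            (Bad-respects em κ regular ω₁ isω₁ square η) proj₁ stationary
            (Bad-upward em κ regular ω₁ isω₁ square η)
    in Bad-nonreflecting em κ regular ω₁ isω₁ square η η∈Γ W ω₁≃W ω₁⊆W reflects
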